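{- If $a\in\mathcal{F}$, then $m(a)=2^{ -d(a)-1}$ and $m(s(a))=m(a)/2$.
   Context: The fuse operation is the partial binary operation on real numbers $a\sim b=(a+b+1)/2$, applicable only when $|a-b|<1$. A fusible number is a real number obtainable from $0$ by finitely many (valid) applications of the fuse operation; i.e. the set $\mathcal{F}$ of fusible numbers is the smallest subset of $\mathbb{R}$ such that $0\in\mathcal{F}$ and, whenever $a,b\in\mathcal{F}$ and $|a-b|<1$, also $(a+b+1)/2\in\mathcal{F}$. The set $\mathcal{F}$ is well-ordered by the usual order of $\mathbb{R}$. For $a\in\mathbb{R}$ define $s(a)=\min\{b\in\mathcal{F}: b>a\}$ and $m(a)=s(a)-a$. An expression is a formal term built from the constant $0$ and the binary symbol $\sim$ (equivalently, a finite full binary tree with leaves labelled $0$). It is valid if, on evaluating it, every application of $\sim$ is to operands $a,b$ with $|a-b|<1$. A valid expression $\alpha$ is called a presentation of its value $v(\alpha)\in\mathbb{R}$ (so $v(0)=0$ and $v(\alpha\sim\beta)=(v(\alpha)+v(\beta)+1)/2$). The depth of an expression is defined by $d(0)=0$ and $d(\alpha\sim\beta)=\max\{d(\alpha),d(\beta)\}+1$. The depth $d(a)$ of a fusible number $a$ is the maximal depth among all presentations of $a$. -}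

module Defs where

open import Algebra.Definitions.RawSemiring using () renaming (_^_ to pow)
open import Data.Nat.Base as ℕ using (ℕ; zero; suc; _⊔_)
open import Data.Product.Base using (_×_; ∃-syntax)
open import Data.Rational.Base
  using (ℚ; 0ℚ; 1ℚ; ½; _+_; _-_; _*_; _<_; _≤_; ∣_∣; +-*-rawSemiring)
open import Relation.Binary.PropositionalEquality.Core using (_≡_)

-- Fusing preserves ℚ and starts from 0, so the smallest subset of ℝ with the
-- required closure properties lies in ℚ.  It is therefore generated inside ℚ.

fuse : ℚ → ℚ → ℚ
fuse a b = ½ * (a + b + 1ℚ)

Fusable : ℚ → ℚ → Set
Fusable a b = ∣ a - b ∣ < 1ℚ

data Fusible : ℚ → Set where
  zero-fusible : Fusible 0ℚ
  fuse-fusible : ∀ {a b} → Fusible a → Fusible b → Fusable a b →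
                 Fusible (fuse a b)

infix 5 _∼_

data Expr : Set where
  𝟎   : Expr
  _∼_ : Expr → Expr → Expr

value : Expr → ℚ
value 𝟎       = 0ℚ
value (α ∼ β) = fuse (value α) (value β)

depth : Expr → ℕ
depth 𝟎       = zero
depth (α ∼ β) = suc (depth α ⊔ depth β)

data Valid : Expr → Set where
  valid-𝟎 : Valid 𝟎
  valid-∼ : ∀ {α β} → Valid α → Valid β → Fusable (value α) (value β) →
            Valid (α ∼ β)

_Presents_ : Expr → ℚ → Set
α Presents a = Valid α × value α ≡ a

-- The functions d, s and m, defined by a maximum or a minimum, are
-- represented by their graphs, which are single-valued by antisymmetry of ≤.

-- d(a) = n
IsDepth : ℚ → ℕ → Set
IsDepth a n = (∃[ α ] α Presents a × depth α ≡ n)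
            × (∀ α → α Presents a → depth α ℕ.≤ n)

-- s(a) = b
IsSuccessor : ℚ → ℚ → Set
IsSuccessor a b = (Fusible b × a < b)
                × (∀ c → Fusible c → a < c → b ≤ c)

-- m(a) = x
IsGap : ℚ → ℚ → Set
IsGap a x = ∃[ b ] IsSuccessor a b × x ≡ b - a

infixr 8 _^_

_^_ : ℚ → ℕ → ℚ
_^_ = pow +-*-rawSemiring

module Submission where

-- A presentation of depth n has its value in 2⁻ⁿℕ, and increasing its deepest
-- leaf shows that a of depth n is followed by fusible numbers converging from
-- below to a + 2⁻ⁿ, the first being a + 2⁻ⁿ⁻¹.  Conversely, if b = s(a) then
-- *every* presentation of b has one and the same depth n, and a = b − 2⁻ⁿ has a
-- presentation of depth n − 1: this goes by induction on the presentation of b,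
-- lowering its deeper operand.  Both parts of the theorem follow once s(a) and
-- s(s(a)) are known to exist.
--
-- Existence of successors is where the strength of the theorem lies (the order
-- type is ε₀).  Let w = u ∼ v with u ≤ v.  Then u ≤ w − ½, and if σ ≤ u then
-- v ≤ 2w − σ − 1, which is twice as far below σ + 1 as w is.  Hence a triple
-- induction, on half-integer levels, on σ and on the scale of σ + 1 − w, reduces
-- questions about w to operands already treated; it yields well-foundedness of
-- the order and, by means of it, the fusible neighbours of every rational.

open import Defs
open import Data.Empty using (⊥-elim)
open import Data.Integer.Base as ℤ using (+_; -[1+_])
import Data.Integer.Properties as ℤ
open import Data.List.Base using ([]; _∷_)
open import Data.Nat.Base as ℕ using (ℕ; zero; suc; z≤n; s≤s)
import Data.Nat.Properties as ℕ
open import Data.Product.Base using (_×_; _,_; ∃-syntax; proj₁; proj₂)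
open import Data.Rational.Base
  using (ℚ; mkℚ; *<*; 0ℚ; 1ℚ; ½; _+_; _-_; -_; _*_; _⊔_; _⊓_; _<_; _≤_; ∣_∣; 1/_;
         positive)
open import Data.Rational.Literals using (fromℤ)
open import Data.Rational.Properties
import Data.Rational.Unnormalised.Base as ℚᵘ
import Data.Rational.Unnormalised.Properties as ℚᵘ
open import Data.Sum.Base using (_⊎_; inj₁; inj₂; [_,_]′)
open import Function.Base using (id)
open import Induction.WellFounded using (Acc; acc)
open import Level using (0ℓ)
open import Relation.Binary.PropositionalEquality
open import Relation.Nullary using (¬_; yes; no; contradiction)
open import Relation.Nullary.Decidable using (dec⇒maybe)
open import Tactic.RingSolver using (solve)
open import Tactic.RingSolver.Core.AlmostCommutativeRing
  using (AlmostCommutativeRing; fromCommutativeRing)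
open import Algebra.Properties.Monoid.Mult +-0-monoid
  using (×-homo-+) renaming (_×_ to _·_)

-- Arithmetic of `fuse` and of powers of ½

ℚ-ring : AlmostCommutativeRing 0ℓ 0ℓ
ℚ-ring = fromCommutativeRing +-*-commutativeRing λ q → dec⇒maybe (0ℚ ≟ q)

<⇒≱ : ∀ {p q} → p < q → ¬ q ≤ p
<⇒≱ p<q q≤p = <-irrefl refl (<-≤-trans p<q q≤p)

-- A linear inequality x ≤ y is proved by adding up hypotheses to p ≤ q and
-- checking y − x = q − p as a ring identity.
by-≤ : ∀ {p q} x y → p ≤ q → y + p ≡ x + q → x ≤ y
by-≤ x y p≤q eq = ≮⇒≥ λ y<x → <-irrefl eq (+-mono-<-≤ y<x p≤q)

by-< : ∀ {p q} x y → p < q → y + p ≡ x + q → x < y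
by-< x y p<q eq = ≰⇒> λ y≤x → <-irrefl eq (+-mono-≤-< y≤x p<q)

fusable : ∀ a b → a < b + 1ℚ → b < a + 1ℚ → Fusable a b
fusable a b a<b+1 b<a+1 with ∣p∣≡p∨∣p∣≡-p (a - b)
... | inj₁ eq = subst (_< 1ℚ) (sym eq) (by-< (a - b) 1ℚ a<b+1 (solve (a ∷ b ∷ []) ℚ-ring))
... | inj₂ eq = subst (_< 1ℚ) (sym eq) (by-< (- (a - b)) 1ℚ b<a+1 (solve (a ∷ b ∷ []) ℚ-ring))

p≤∣p∣ : ∀ p → p ≤ ∣ p ∣
p≤∣p∣ p with ≤-total 0ℚ p
... | inj₁ 0≤p = ≤-reflexive (sym (0≤p⇒∣p∣≡p 0≤p))
... | inj₂ p≤0 = ≤-trans p≤0 (0≤∣p∣ p)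

fusable⇒< : ∀ a b → Fusable a b → a < b + 1ℚ
fusable⇒< a b h = by-< a (b + 1ℚ) (≤-<-trans (p≤∣p∣ (a - b)) h) (solve (a ∷ b ∷ []) ℚ-ring)

fusable-sym : ∀ a b → Fusable a b → Fusable b a
fusable-sym a b = subst (_< 1ℚ) (trans (sym (∣-p∣≡∣p∣ (a - b))) (cong ∣_∣ (flip-diff a b)))
  where
  flip-diff : ∀ a b → - (a - b) ≡ b - a
  flip-diff a b = solve (a ∷ b ∷ []) ℚ-ring

½*-mono-≤ : ∀ {p q} → p ≤ q → ½ * p ≤ ½ * q
½*-mono-≤ = *-monoˡ-≤-nonNeg ½

½*-mono-< : ∀ {p q} → p < q → ½ * p < ½ * q
½*-mono-< = *-monoʳ-<-pos ½

fusable⇒> : ∀ a b → Fusable a b → b < a + 1ℚ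
fusable⇒> a b h = fusable⇒< b a (fusable-sym a b h)

fuse-comm : ∀ a b → fuse a b ≡ fuse b a
fuse-comm a b = cong (λ s → ½ * (s + 1ℚ)) (+-comm a b)

fuse-mono-≤ : ∀ {a b c d} → a ≤ c → b ≤ d → fuse a b ≤ fuse c d
fuse-mono-≤ a≤c b≤d = ½*-mono-≤ (+-monoˡ-≤ 1ℚ (+-mono-≤ a≤c b≤d))

fuse-mono-<-≤ : ∀ {a b c d} → a < c → b ≤ d → fuse a b < fuse c d
fuse-mono-<-≤ a<c b≤d = ½*-mono-< (+-monoˡ-< 1ℚ (+-mono-<-≤ a<c b≤d))

fuse-mono-≤-< : ∀ {a b c d} → a ≤ c → b < d → fuse a b < fuse c d
fuse-mono-≤-< a≤c b<d = ½*-mono-< (+-monoˡ-< 1ℚ (+-mono-≤-< a≤c b<d))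

fuse-[b+1,b] : ∀ b → fuse (b + 1ℚ) b ≡ b + 1ℚ
fuse-[b+1,b] b = unfolded b
  where
  unfolded : ∀ b → ½ * ((b + 1ℚ) + b + 1ℚ) ≡ b + 1ℚ
  unfolded b = solve (b ∷ []) ℚ-ring

fuse-idem : ∀ a → fuse a a ≡ a + ½
fuse-idem a = unfolded a
  where
  unfolded : ∀ a → ½ * (a + a + 1ℚ) ≡ a + ½
  unfolded a = solve (a ∷ []) ℚ-ring

-- rest c a is the number that fuses with a to c.
rest : ℚ → ℚ → ℚ
rest c a = c + c - a - 1ℚ

fuse-rest : ∀ c a → fuse a (rest c a) ≡ c
fuse-rest c a = unfolded c a
  where
  unfolded : ∀ c a → ½ * (a + (c + c - a - 1ℚ) + 1ℚ) ≡ c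
  unfolded c a = solve (c ∷ a ∷ []) ℚ-ring

0<1 : 0ℚ < 1ℚ
0<1 = positive⁻¹ 1ℚ

p<p+q : ∀ p {q} → 0ℚ < q → p < p + q
p<p+q p {q} 0<q = by-< p (p + q) 0<q (solve (p ∷ q ∷ []) ℚ-ring)

p<p+1 : ∀ p → p < p + 1ℚ
p<p+1 p = p<p+q p 0<1

½*p>0 : ∀ {p} → 0ℚ < p → 0ℚ < ½ * p
½*p>0 = ½*-mono-<

½*p<p : ∀ {p} → 0ℚ < p → ½ * p < p
½*p<p {p} 0<p = by-< (½ * p) p (½*p>0 0<p) (solve (p ∷ []) ℚ-ring)

½^n>0 : ∀ n → 0ℚ < ½ ^ n
½^n>0 zero    = 0<1
½^n>0 (suc n) = ½*p>0 (½^n>0 n)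

½^-antitone : ∀ {m n} → m ℕ.≤ n → ½ ^ n ≤ ½ ^ m
½^-antitone {n = zero}  z≤n       = ≤-refl
½^-antitone {n = suc n} z≤n       = ≤-trans (<⇒≤ (½*p<p (½^n>0 n))) (½^-antitone {n = n} z≤n)
½^-antitone             (s≤s m≤n) = ½*-mono-≤ (½^-antitone m≤n)

fromℤ-suc : ∀ n → fromℤ (+ suc n) ≡ 1ℚ + fromℤ (+ n)
fromℤ-suc n = toℚᵘ-injective (ℚᵘ.≃-trans
  (ℚᵘ.*≡* (cong (λ i → (+ 1 ℤ.+ i) ℤ.* + 1) (sym (ℤ.*-identityʳ (+ n)))))
  (ℚᵘ.≃-sym (toℚᵘ-homo-+ 1ℚ (fromℤ (+ n)))))

archimedean : ∀ c → ∃[ n ] c < n · 1ℚ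
archimedean c@(mkℚ i d-1 _) =
  suc ℤ.∣ i ∣ , subst (c <_) (fromℤ≡· (suc ℤ.∣ i ∣)) (*<* i<)
  where
  fromℤ≡· : ∀ n → fromℤ (+ n) ≡ n · 1ℚ
  fromℤ≡· zero    = refl
  fromℤ≡· (suc n) = trans (fromℤ-suc n) (cong (_+_ 1ℚ) (fromℤ≡· n))
  i< : i ℤ.* + 1 ℤ.< + suc ℤ.∣ i ∣ ℤ.* + suc d-1
  i< = begin-strict
    i ℤ.* + 1                    ≡⟨ ℤ.*-identityʳ i ⟩
    i                            <⟨ i<1+∣i∣ i ⟩
    + suc ℤ.∣ i ∣                ≡⟨ ℤ.*-identityʳ (+ suc ℤ.∣ i ∣) ⟨
    + suc ℤ.∣ i ∣ ℤ.* + 1        ≤⟨ ℤ.*-monoˡ-≤-nonNeg (+ suc ℤ.∣ i ∣) (ℤ.+≤+ (s≤s z≤n)) ⟩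
    + suc ℤ.∣ i ∣ ℤ.* + suc d-1  ∎
    where
    open ℤ.≤-Reasoning
    i<1+∣i∣ : ∀ i → i ℤ.< + suc ℤ.∣ i ∣
    i<1+∣i∣ (+ n)    = ℤ.+<+ (ℕ.n<1+n n)
    i<1+∣i∣ -[1+ n ] = ℤ.-<+

½^n*n≤1 : ∀ n → ½ ^ n * (n · 1ℚ) ≤ 1ℚ
½^n*n≤1 zero    = <⇒≤ 0<1
½^n*n≤1 (suc n) = unfolded (½ ^ n) (n · 1ℚ) (½^n*n≤1 n) (½^-antitone {0} {n} z≤n)
  where
  unfolded : ∀ h k → h * k ≤ 1ℚ → h ≤ 1ℚ → (½ * h) * (1ℚ + k) ≤ 1ℚ
  unfolded h k hk≤1 h≤1 = by-≤ ((½ * h) * (1ℚ + k)) 1ℚ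
    (½*-mono-≤ (+-mono-≤ hk≤1 h≤1)) (solve (h ∷ k ∷ []) ℚ-ring)

½^-vanishes : ∀ {ε} → 0ℚ < ε → ∃[ n ] ½ ^ n < ε
½^-vanishes {ε} 0<ε = n , *-cancelʳ-<-nonNeg (1/ ε) (begin-strict
  ½ ^ n * 1/ ε      <⟨ *-monoʳ-<-pos (½ ^ n) {{positive (½^n>0 n)}} 1/ε<n ⟩
  ½ ^ n * (n · 1ℚ)  ≤⟨ ½^n*n≤1 n ⟩
  1ℚ                ≡⟨ *-inverseʳ ε ⟨
  ε * 1/ ε          ∎)
  where
  open ≤-Reasoning
  instance
    ε>0   = positive 0<ε
    ε≢0   = pos⇒nonZero ε
    1/ε≥0 = pos⇒nonNeg (1/ ε) {{1/pos⇒pos ε}}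
  n = proj₁ (archimedean (1/ ε))
  1/ε<n = proj₂ (archimedean (1/ ε))

-- Multiples of a common step

IsMultiple : ℚ → ℚ → Set
IsMultiple h q = ∃[ k ] q ≡ k · h

multiple-+ : ∀ {h p q} → IsMultiple h p → IsMultiple h q → IsMultiple h (p + q)
multiple-+ {h} (k , refl) (l , refl) = k ℕ.+ l , sym (×-homo-+ h k l)

multiple-½ : ∀ {h q} → IsMultiple h q → IsMultiple (½ * h) (½ * q)
multiple-½ {h} (k , refl) = k , ½*-· k
  where
  ½*-· : ∀ k → ½ * (k · h) ≡ k · (½ * h)
  ½*-· zero    = refl
  ½*-· (suc k) = trans (*-distribˡ-+ ½ h (k · h)) (cong (_+_ (½ * h)) (½*-· k))

½p+½p≡p : ∀ p → ½ * p + ½ * p ≡ p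
½p+½p≡p p = solve (p ∷ []) ℚ-ring

multiple-refine : ∀ {h q} → IsMultiple h q → IsMultiple (½ * h) q
multiple-refine {h} {q} m =
  subst (IsMultiple (½ * h)) (½p+½p≡p q) (multiple-+ (multiple-½ m) (multiple-½ m))

multiple-1 : ∀ n → IsMultiple (½ ^ n) 1ℚ
multiple-1 zero    = 1 , refl
multiple-1 (suc n) = multiple-refine (multiple-1 n)

multiple-value : ∀ α {n} → depth α ℕ.≤ n → IsMultiple (½ ^ n) (value α)
multiple-value 𝟎       _                   = 0 , refl
multiple-value (α ∼ β) {suc n} (s≤s α⊔β≤n) = multiple-½ (multiple-+ (multiple-+
  (multiple-value α (ℕ.m⊔n≤o⇒m≤o _ _ α⊔β≤n))
  (multiple-value β (ℕ.m⊔n≤o⇒n≤o _ _ α⊔β≤n))) (multiple-1 n))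

·-mono : ∀ {h k l} → 0ℚ < h → k ℕ.≤ l → k · h ≤ l · h
·-mono {l = zero}  0<h z≤n       = ≤-refl
·-mono {l = suc l} 0<h z≤n       = +-mono-≤ (<⇒≤ 0<h) (·-mono {l = l} 0<h z≤n)
·-mono {h}         0<h (s≤s k≤l) = +-monoʳ-≤ h (·-mono 0<h k≤l)

-- Discreteness: with `h = ½ ^ n`, it turns the strict bounds in fusability and in gaps into room
-- for a whole `h`.
multiple-step : ∀ {h p q} → 0ℚ < h → IsMultiple h p → IsMultiple h q → p < q → p + h ≤ q
multiple-step {h} 0<h (k , refl) (l , refl) kh<lh with suc k ℕ.≤? l
... | yes k<l = ≤-trans (≤-reflexive (+-comm (k · h) h)) (·-mono 0<h k<l)
... | no  k≮l = contradiction (·-mono 0<h (ℕ.≮⇒≥ k≮l)) (<⇒≱ kh<lh)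

-- Depths and gaps

-- Weaker than `IsDepth`: one number may have several such `n`. Maximality comes only from the gap
-- above `a`, in `successor-gap`.
HasDepth : ℚ → ℕ → Set
HasDepth a n = ∃[ α ] α Presents a × depth α ≡ n

hasDepth⇒fusible : ∀ {a n} → HasDepth a n → Fusible a
hasDepth⇒fusible (α , (v , refl) , _) = valid⇒fusible v
  where
  valid⇒fusible : ∀ {α} → Valid α → Fusible (value α)
  valid⇒fusible valid-𝟎         = zero-fusible
  valid⇒fusible (valid-∼ u v h) = fuse-fusible (valid⇒fusible u) (valid⇒fusible v) h

hasDepth-𝟎 : HasDepth 0ℚ 0
hasDepth-𝟎 = 𝟎 , (valid-𝟎 , refl) , refl

hasDepth-fuse : ∀ {a b m n} → HasDepth a m → HasDepth b n → Fusable a b →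
                HasDepth (fuse a b) (suc (m ℕ.⊔ n))
hasDepth-fuse (α , (u , refl) , refl) (β , (v , refl) , refl) h =
  α ∼ β , (valid-∼ u v h , refl) , refl

fusible⇒hasDepth : ∀ {a} → Fusible a → ∃[ n ] HasDepth a n
fusible⇒hasDepth zero-fusible = 0 , hasDepth-𝟎
fusible⇒hasDepth (fuse-fusible u v h) =
  _ , hasDepth-fuse (proj₂ (fusible⇒hasDepth u)) (proj₂ (fusible⇒hasDepth v)) h

hasDepth⇒multiple : ∀ {a m n} → HasDepth a m → m ℕ.≤ n → IsMultiple (½ ^ n) a
hasDepth⇒multiple (α , (_ , refl) , refl) = multiple-value α

-- `a + 1` is `(a ∼ a) ∼ (a ∼ a)`.
hasDepth-+1 : ∀ {a n} → HasDepth a n → HasDepth (a + 1ℚ) (suc (suc n))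
hasDepth-+1 {a} {n} d = subst₂ HasDepth (fuse²-idem a) (cong suc (ℕ.⊔-idem (suc n)))
  (double (subst (λ k → HasDepth (fuse a a) (suc k)) (ℕ.⊔-idem n) (double d)))
  where
  double : ∀ {a n} → HasDepth a n → HasDepth (fuse a a) (suc (n ℕ.⊔ n))
  double {a} d = hasDepth-fuse d d (fusable a a (p<p+1 a) (p<p+1 a))
  fuse²-idem : ∀ a → fuse (fuse a a) (fuse a a) ≡ a + 1ℚ
  fuse²-idem a = unfolded a
    where
    unfolded : ∀ a → ½ * (½ * (a + a + 1ℚ) + ½ * (a + a + 1ℚ) + 1ℚ) ≡ a + 1ℚ
    unfolded a = solve (a ∷ []) ℚ-ring

fuse-+½ : ∀ a b h → fuse (a + h) b ≡ fuse a b + ½ * h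
fuse-+½ a b h = unfolded a b h
  where
  unfolded : ∀ a b h → ½ * ((a + h) + b + 1ℚ) ≡ ½ * (a + b + 1ℚ) + ½ * h
  unfolded a b h = solve (a ∷ b ∷ h ∷ []) ℚ-ring

-- Recursion into the deeper operand: raising it by `½ ^ suc m` raises the fuse by half of that. It
-- stays fusable, since `a < b + 1` between multiples of `½ ^ m` leaves room for `½ ^ m`.
hasDepth-+½^ : ∀ {a n} → HasDepth a n → HasDepth (a + ½ ^ suc n) (suc n)
hasDepth-+½^ (α , (v , refl) , refl) = go v
  where
  fuse-deeper : ∀ {a b m n} → n ℕ.≤ m → HasDepth a m → HasDepth b n → Fusable a b →
                HasDepth (a + ½ ^ suc m) (suc m) →
                HasDepth (fuse a b + ½ ^ suc (suc m)) (suc (suc m))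
  fuse-deeper {a} {b} {m} {n} n≤m da db a~b da′ =
    subst₂ HasDepth (fuse-+½ a b (½ ^ suc m)) (cong suc (ℕ.m≥n⇒m⊔n≡m (ℕ.m≤n⇒m≤1+n n≤m)))
      (hasDepth-fuse da′ db (fusable (a + ½ ^ suc m) b a′<b+1 b<a′+1))
    where
    a′<b+1 : a + ½ ^ suc m < b + 1ℚ
    a′<b+1 = <-≤-trans (+-monoʳ-< a (½*p<p (½^n>0 m)))
      (multiple-step (½^n>0 m) (hasDepth⇒multiple da ℕ.≤-refl)
        (multiple-+ (hasDepth⇒multiple db n≤m) (multiple-1 m)) (fusable⇒< a b a~b))
    b<a′+1 : b < a + ½ ^ suc m + 1ℚ
    b<a′+1 = <-trans (fusable⇒> a b a~b) (+-monoˡ-< 1ℚ (p<p+q a (½^n>0 (suc m))))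
  go : ∀ {α} → Valid α → HasDepth (value α + ½ ^ suc (depth α)) (suc (depth α))
  go valid-𝟎 = 𝟎 ∼ 𝟎 , (valid-∼ valid-𝟎 valid-𝟎 (fusable 0ℚ 0ℚ 0<1 0<1) , refl) , refl
  go (valid-∼ {α} {β} u v h) with ℕ.≤-total (depth β) (depth α)
  ... | inj₁ β≤α =
    subst (λ n → HasDepth (fuse (value α) (value β) + ½ ^ suc (suc n)) (suc (suc n)))
      (sym (ℕ.m≥n⇒m⊔n≡m β≤α))
      (fuse-deeper β≤α (α , (u , refl) , refl) (β , (v , refl) , refl) h (go u))
  ... | inj₂ α≤β =
    subst₂ (λ a n → HasDepth (a + ½ ^ suc (suc n)) (suc (suc n)))
      (fuse-comm (value β) (value α)) (sym (ℕ.m≤n⇒m⊔n≡n α≤β))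
      (fuse-deeper α≤β (β , (v , refl) , refl) (α , (u , refl) , refl)
        (fusable-sym (value α) (value β) h) (go v))

-- Each step adds half of the distance left to `a + ½ ^ n`.
hasDepth-approach : ∀ {a n} → HasDepth a n →
                    ∀ k → HasDepth (a + (½ ^ n - ½ ^ (k ℕ.+ n))) (k ℕ.+ n)
hasDepth-approach {a} {n} d zero = subst (λ q → HasDepth q n) (a≡ a (½ ^ n)) d
  where
  a≡ : ∀ a h → a ≡ a + (h - h)
  a≡ a h = solve (a ∷ h ∷ []) ℚ-ring
hasDepth-approach {a} {n} d (suc k) = subst (λ q → HasDepth q (suc k ℕ.+ n))
  (next a (½ ^ n) (½ ^ (k ℕ.+ n))) (hasDepth-+½^ (hasDepth-approach d k))
  where
  next : ∀ a h r → a + (h - r) + ½ * r ≡ a + (h - ½ * r)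
  next a h r = solve (a ∷ h ∷ r ∷ []) ℚ-ring

NoFusibleIn : ℚ → ℚ → Set
NoFusibleIn c x = ∀ {w} → Fusible w → c < w → ¬ w < x

fusibles-accumulate : ∀ {a n c} → HasDepth a n → c < a + ½ ^ n → ¬ NoFusibleIn c (a + ½ ^ n)
fusibles-accumulate {a} {n} {c} d c<a+h free =
  free (hasDepth⇒fusible (hasDepth-approach d k)) c<w w<a+h
  where
  0<ε : 0ℚ < (a + ½ ^ n) - c
  0<ε = unfolded a (½ ^ n) c<a+h
    where
    unfolded : ∀ a h → c < a + h → 0ℚ < (a + h) - c
    unfolded a h c<a+h = by-< 0ℚ ((a + h) - c) c<a+h (solve (a ∷ h ∷ c ∷ []) ℚ-ring)
  k = proj₁ (½^-vanishes 0<ε)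
  r<ε : ½ ^ (k ℕ.+ n) < (a + ½ ^ n) - c
  r<ε = ≤-<-trans (½^-antitone (ℕ.m≤m+n k n)) (proj₂ (½^-vanishes 0<ε))
  c<w : c < a + (½ ^ n - ½ ^ (k ℕ.+ n))
  c<w = unfolded (½ ^ n) (½ ^ (k ℕ.+ n)) r<ε
    where
    unfolded : ∀ h r → r < (a + h) - c → c < a + (h - r)
    unfolded h r r<ε = by-< c (a + (h - r)) r<ε (solve (a ∷ c ∷ h ∷ r ∷ []) ℚ-ring)
  w<a+h : a + (½ ^ n - ½ ^ (k ℕ.+ n)) < a + ½ ^ n
  w<a+h = unfolded (½ ^ n) (½ ^ (k ℕ.+ n)) (½^n>0 (k ℕ.+ n))
    where
    unfolded : ∀ h r → 0ℚ < r → a + (h - r) < a + h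
    unfolded h r 0<r = by-< (a + (h - r)) (a + h) 0<r (solve (a ∷ h ∷ r ∷ []) ℚ-ring)

fuse-+1≤ : ∀ a b → a + 1ℚ ≤ b → fuse a b ≤ b
fuse-+1≤ = unfolded
  where
  unfolded : ∀ a b → a + 1ℚ ≤ b → ½ * (a + b + 1ℚ) ≤ b
  unfolded a b a+1≤b = by-≤ (½ * (a + b + 1ℚ)) b (½*-mono-≤ a+1≤b) (solve (a ∷ b ∷ []) ℚ-ring)

b<fuse : ∀ a b → b < a + 1ℚ → b < fuse a b
b<fuse = unfolded
  where
  unfolded : ∀ a b → b < a + 1ℚ → b < ½ * (a + b + 1ℚ)
  unfolded a b b<a+1 = by-< b (½ * (a + b + 1ℚ)) (½*-mono-< b<a+1) (solve (a ∷ b ∷ []) ℚ-ring)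

fuse-restˡ : ∀ c b → fuse (rest c b) b ≡ c
fuse-restˡ c b = trans (fuse-comm (rest c b) b) (fuse-rest c b)

rest<⇒<fuse : ∀ a b {c} → rest c b < a → c < fuse a b
rest<⇒<fuse a b {c} h = subst (_< fuse a b) (fuse-restˡ c b) (fuse-mono-<-≤ h (≤-refl {b}))

<fuse⇒rest< : ∀ a b {c} → c < fuse a b → rest c b < a
<fuse⇒rest< a b {c} h = ≰⇒> λ a≤r →
  <⇒≱ h (subst (fuse a b ≤_) (fuse-restˡ c b) (fuse-mono-≤ a≤r (≤-refl {b})))

-- A fusible `z` in the operand's interval would put a fusible number between `c` and `fuse p q`:
-- `fuse z q` if `q < z + 1`, and otherwise `q` itself, as then `c < fuse z q ≤ q < fuse p q`.
noFusibleIn-rest : ∀ {p q c} → Fusible q → Fusable p q →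
                   NoFusibleIn c (fuse p q) → NoFusibleIn (rest c q) p
noFusibleIn-rest {p} {q} {c} fq p~q free {z} fz r<z z<p with q <? z + 1ℚ
... | yes q<z+1 = free
  (fuse-fusible fz fq (fusable z q (<-trans z<p (fusable⇒< p q p~q)) q<z+1))
  (rest<⇒<fuse z q r<z) (fuse-mono-<-≤ z<p (≤-refl {q}))
... | no  q≮z+1 = free fq
  (<-≤-trans (rest<⇒<fuse z q r<z) (fuse-+1≤ z q (≮⇒≥ q≮z+1)))
  (b<fuse p q (fusable⇒> p q p~q))

-- The lower end `c` is any rational, because passing to an operand replaces it by `rest c q`, which
-- may not be fusible.
Predecessor : ℚ → ℚ → ℕ → Set
Predecessor c x zero    = x ≡ 0ℚ
Predecessor c x (suc n) = ∃[ g ] HasDepth g n × g ≤ c × g + ½ ^ suc n ≡ x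

predecessor : ∀ {x n c} → HasDepth x n → c < x → NoFusibleIn c x → Predecessor c x n
predecessor (ξ , (v , refl) , refl) = go v
  where
  depth-0 : ∀ {a} → HasDepth a 0 → a ≡ 0ℚ
  depth-0 (𝟎 , (_ , a≡0) , _) = sym a≡0
  -- `p` is the deeper operand. If it is `g + ½ ^ m` with `g` of depth `m − 1`, then `fuse g q` lies
  -- `½ ^ suc m` below `fuse p q`; it has depth `m` if the fuse is valid and `q` is no deeper than
  -- `g`.
  fuse-predecessor : ∀ {p q m n c} → n ℕ.≤ m → HasDepth p m → HasDepth q n → Fusable p q →
                     c < fuse p q → NoFusibleIn c (fuse p q) →
                     Predecessor (rest c q) p m → Predecessor c (fuse p q) (suc m)
  -- Both operands are 0, so the value is ½, and 0 must not lie in the gap.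
  fuse-predecessor {m = zero} {c = c} z≤n _ dq _ c<x free p≡0 =
    0ℚ , hasDepth-𝟎 , ≮⇒≥ (λ c<0 → free zero-fusible c<0 (subst (0ℚ <_) ½≡x (positive⁻¹ ½))) , ½≡x
    where
    ½≡x = sym (cong₂ fuse p≡0 (depth-0 dq))
  fuse-predecessor {q = q} {suc m} {n} {c} n≤1+m dp dq p~q c<x free (g , dg , g≤r , refl)
    with q <? g + 1ℚ | ℕ.m≤n⇒m<n∨m≡n n≤1+m
  ... | yes q<g+1 | inj₁ (s≤s n≤m) = fuse g q
    , subst (λ k → HasDepth (fuse g q) (suc k)) (ℕ.m≥n⇒m⊔n≡m n≤m)
        (hasDepth-fuse dg dq (fusable g q g<q+1 q<g+1))
    , subst (fuse g q ≤_) (fuse-restˡ c q) (fuse-mono-≤ g≤r (≤-refl {q}))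
    , sym (fuse-+½ g q (½ ^ suc m))
    where
    g<q+1 : g < q + 1ℚ
    g<q+1 = <-trans (p<p+q g (½^n>0 (suc m))) (fusable⇒< (g + ½ ^ suc m) q p~q)
  -- Operands of equal depth, and the boundary case q = g + 1, give limits of
  -- fusible numbers from below, which have no gap below them.
  ... | yes q<g+1 | inj₂ refl =
    ⊥-elim (fusibles-accumulate d (subst (c <_) x≡ c<x) (subst (NoFusibleIn c) x≡ free))
    where
    g<q+1 : g < q + 1ℚ
    g<q+1 = <-trans (p<p+q g (½^n>0 (suc m))) (fusable⇒< (g + ½ ^ suc m) q p~q)
    d : HasDepth (fuse g q) (suc (suc m))
    d = subst (λ k → HasDepth (fuse g q) (suc k)) (ℕ.m≤n⇒m⊔n≡n (ℕ.n≤1+n m))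
          (hasDepth-fuse dg dq (fusable g q g<q+1 q<g+1))
    x≡ : fuse (g + ½ ^ suc m) q ≡ fuse g q + ½ ^ suc (suc m)
    x≡ = fuse-+½ g q (½ ^ suc m)
  ... | no q≮g+1 | _ =
    ⊥-elim (fusibles-accumulate (hasDepth-+1 dg) (subst (c <_) x≡ c<x)
      (subst (NoFusibleIn c) x≡ free))
    where
    q≤g+1 : q ≤ g + 1ℚ
    -- By discreteness, `q < p + 1` improves to `q + ½ ^ suc m ≤ p + 1`.
    q≤g+1 = unfolded (½ ^ suc m) (multiple-step (½^n>0 (suc m)) (hasDepth⇒multiple dq n≤1+m)
      (multiple-+ (hasDepth⇒multiple dp ℕ.≤-refl) (multiple-1 (suc m)))
      (fusable⇒> (g + ½ ^ suc m) q p~q))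
      where
      unfolded : ∀ h → q + h ≤ (g + h) + 1ℚ → q ≤ g + 1ℚ
      unfolded h le = by-≤ q (g + 1ℚ) le (solve (q ∷ g ∷ h ∷ []) ℚ-ring)
    x≡ : fuse (g + ½ ^ suc m) q ≡ (g + 1ℚ) + ½ ^ suc (suc m)
    x≡ = trans (cong (fuse (g + ½ ^ suc m)) (≤-antisym q≤g+1 (≮⇒≥ q≮g+1)))
           (unfolded g (½ ^ suc m))
      where
      unfolded : ∀ g h → ½ * ((g + h) + (g + 1ℚ) + 1ℚ) ≡ (g + 1ℚ) + ½ * h
      unfolded g h = solve (g ∷ h ∷ []) ℚ-ring
  go : ∀ {ξ c} → Valid ξ → c < value ξ → NoFusibleIn c (value ξ) →
       Predecessor c (value ξ) (depth ξ)
  go valid-𝟎 _ _ = refl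
  go {c = c} (valid-∼ {α} {β} u v h) c<x free with ℕ.≤-total (depth β) (depth α)
  ... | inj₁ β≤α =
    subst (λ n → Predecessor c (fuse (value α) (value β)) (suc n)) (sym (ℕ.m≥n⇒m⊔n≡m β≤α))
      (fuse-predecessor β≤α dα dβ h c<x free
        (go u (<fuse⇒rest< (value α) (value β) c<x)
          (noFusibleIn-rest (hasDepth⇒fusible dβ) h free)))
    where
    dα = α , (u , refl) , refl
    dβ = β , (v , refl) , refl
  ... | inj₂ α≤β =
    subst₂ (λ x n → Predecessor c x (suc n)) comm (sym (ℕ.m≤n⇒m⊔n≡n α≤β))
      (fuse-predecessor α≤β dβ dα β~α c<x′ free′
        (go v (<fuse⇒rest< (value β) (value α) c<x′)
          (noFusibleIn-rest (hasDepth⇒fusible dα) β~α free′)))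
    where
    dα = α , (u , refl) , refl
    dβ = β , (v , refl) , refl
    β~α = fusable-sym (value α) (value β) h
    comm = fuse-comm (value β) (value α)
    c<x′ = subst (c <_) (sym comm) c<x
    free′ : NoFusibleIn c (fuse (value β) (value α))
    free′ = subst (NoFusibleIn c) (sym comm) free

fusible≥0 : ∀ {a} → Fusible a → 0ℚ ≤ a
fusible≥0 zero-fusible = ≤-refl
fusible≥0 (fuse-fusible u v _) =
  ≤-trans (nonNegative⁻¹ ½) (fuse-mono-≤ (fusible≥0 u) (fusible≥0 v))

fusible≮0 : ∀ {w} → Fusible w → ¬ w < 0ℚ
fusible≮0 fw w<0 = <⇒≱ w<0 (fusible≥0 fw)

-- `predecessor` supplies `g ≤ a`, and discreteness gives `a ≤ g`. As `e` is the depth of an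
-- arbitrary presentation of `a`, `e ≤ m` makes `m` maximal: a deeper one would put `a + ½ ^ suc e`
-- into the gap.
successor-gap : ∀ {a b e n} → HasDepth a e → HasDepth b n → a < b → NoFusibleIn a b →
                ∃[ m ] n ≡ suc m × HasDepth a m × b ≡ a + ½ ^ suc m × e ℕ.≤ m
successor-gap {n = zero} da db a<b free with refl ← predecessor db a<b free =
  contradiction a<b (fusible≮0 (hasDepth⇒fusible da))
successor-gap {a} {b} {e} {suc m} da db a<b free
  with g , dg , g≤a , refl ← predecessor db a<b free =
  m , refl , subst (λ q → HasDepth q m) g≡a dg , cong (_+ ½ ^ suc m) g≡a , ℕ.≮⇒≥ m≮e
  where
  a≤g : a ≤ g
  a≤g with e ℕ.≤? suc m
  ... | yes e≤n = unfolded (½ ^ suc m) (multiple-step (½^n>0 (suc m))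
    (hasDepth⇒multiple da e≤n) (hasDepth⇒multiple db ℕ.≤-refl) a<b)
    where
    unfolded : ∀ h → a + h ≤ g + h → a ≤ g
    unfolded h le = by-≤ a g le (solve (a ∷ g ∷ h ∷ []) ℚ-ring)
  -- Here `a` and `b` are multiples of `½ ^ e`, so `a + ½ ^ suc e` fits between them.
  ... | no  e≰n = ⊥-elim (free (hasDepth⇒fusible (hasDepth-+½^ da)) (p<p+q a (½^n>0 (suc e)))
    (<-≤-trans (+-monoʳ-< a (½*p<p (½^n>0 e))) (multiple-step (½^n>0 e)
      (hasDepth⇒multiple da ℕ.≤-refl) (hasDepth⇒multiple db (ℕ.<⇒≤ (ℕ.≰⇒> e≰n))) a<b)))
  g≡a : g ≡ a
  g≡a = ≤-antisym g≤a a≤g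
  m≮e : ¬ m ℕ.< e
  m≮e m<e = free (hasDepth⇒fusible (hasDepth-+½^ da)) (p<p+q a (½^n>0 (suc e)))
    (subst (λ q → a + ½ ^ suc e < q + ½ ^ suc m) (sym g≡a)
      (+-monoʳ-< a (<-≤-trans (½*p<p (½^n>0 e)) (½^-antitone m<e))))

successor⇒noFusibleIn : ∀ {a b} → IsSuccessor a b → NoFusibleIn a b
successor⇒noFusibleIn (_ , least) fw a<w w<b = <⇒≱ w<b (least _ fw a<w)

depth-and-gaps : ∀ {a s s₂} → Fusible a → IsSuccessor a s → IsSuccessor s s₂ →
  ∃[ d ] ∃[ s ] ∃[ m ] ∃[ m′ ]
    IsDepth a d × IsSuccessor a s × IsGap a m × IsGap s m′ × m ≡ ½ ^ suc d × m′ ≡ ½ * m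
depth-and-gaps {a} {s} {s₂} fa a-succ@((fs , a<s) , _) s-succ@((fs₂ , s<s₂) , _)
  -- The upper gap comes first: it yields a presentation of `s` whose depth is fixed by `s₂ − s`.
  -- Used for the lower gap, its depth becomes `suc d`, whence the halving.
  with _ , _ , ds , refl , _ ← successor-gap (proj₂ (fusible⇒hasDepth fs))
         (proj₂ (fusible⇒hasDepth fs₂)) s<s₂ (successor⇒noFusibleIn s-succ)
  with d , refl , da , refl , _ ← successor-gap (proj₂ (fusible⇒hasDepth fa)) ds a<s
         (successor⇒noFusibleIn a-succ) =
  d , s , ½ ^ suc d , ½ * ½ ^ suc d , (da , maximal) , a-succ
  , (s , a-succ , gap a (½ ^ suc d)) , (s₂ , s-succ , gap s (½ ^ suc (suc d))) , refl , refl
  where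
  gap : ∀ a h → h ≡ (a + h) - a
  gap a h = solve (a ∷ h ∷ []) ℚ-ring
  maximal : ∀ α → α Presents a → depth α ℕ.≤ d
  maximal α p with _ , refl , _ , _ , α≤d ←
    successor-gap (α , p , refl) ds a<s (successor⇒noFusibleIn a-succ) = α≤d

-- Bounds on the operands of a fuse

rest-antitone-≤ : ∀ c {a b} → a ≤ b → rest c b ≤ rest c a
rest-antitone-≤ c {a} {b} = unfolded a b
  where
  unfolded : ∀ a b → a ≤ b → c + c - b - 1ℚ ≤ c + c - a - 1ℚ
  unfolded a b a≤b = by-≤ (c + c - b - 1ℚ) (c + c - a - 1ℚ) a≤b (solve (a ∷ b ∷ c ∷ []) ℚ-ring)

rest-swap-< : ∀ c {a b} → rest c a < b → rest c b < a
rest-swap-< c {a} {b} = unfolded a b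
  where
  unfolded : ∀ a b → c + c - a - 1ℚ < b → c + c - b - 1ℚ < a
  unfolded a b h = by-< (c + c - b - 1ℚ) a h (solve (a ∷ b ∷ c ∷ []) ℚ-ring)

fuse<⇒<rest : ∀ u v {c} → fuse u v < c → v < rest c u
fuse<⇒<rest u v {c} h = ≰⇒> λ r≤v →
  <⇒≱ h (subst (_≤ fuse u v) (fuse-rest c u) (fuse-mono-≤ (≤-refl {u}) r≤v))

fuse<+1 : ∀ u v → v < u + 1ℚ → fuse u v < u + 1ℚ
fuse<+1 u v v<u+1 = subst (fuse u v <_) (trans (fuse-comm u (u + 1ℚ)) (fuse-[b+1,b] u))
  (fuse-mono-≤-< (≤-refl {u}) v<u+1)

OrderedFuse : ℚ → Set
OrderedFuse w = ∃[ u ] ∃[ v ] Fusible u × Fusible v × u ≤ v × v < u + 1ℚ × w ≡ fuse u v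

orderedFuse : ∀ {w} → Fusible w → w ≡ 0ℚ ⊎ OrderedFuse w
orderedFuse zero-fusible = inj₁ refl
orderedFuse (fuse-fusible {a} {b} fa fb a~b) with ≤-total a b
... | inj₁ a≤b = inj₂ (a , b , fa , fb , a≤b , fusable⇒> a b a~b , refl)
... | inj₂ b≤a = inj₂ (b , a , fb , fa , b≤a , fusable⇒< a b a~b , fuse-comm a b)

+½≤fuse : ∀ {u v} → u ≤ v → u + ½ ≤ fuse u v
+½≤fuse {u} {v} u≤v = subst (_≤ fuse u v) (fuse-idem u) (fuse-mono-≤ (≤-refl {u}) u≤v)

+-cancelʳ-< : ∀ a b c → a + c < b + c → a < b
+-cancelʳ-< a b c h = by-< a b h (solve (a ∷ b ∷ c ∷ []) ℚ-ring)

-- Well-foundedness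

-- The predicate is a parameter so that the fusible numbers below a bound can be cut into pieces.
Below : (ℚ → Set) → ℚ → ℚ → Set
Below P y x = P y × y < x

acc-⊆ : ∀ {P Q x} → (∀ {y} → P y → y < x → Q y) → Acc (Below Q) x → Acc (Below P) x
acc-⊆ P⊆Q (acc rs) = acc λ (Py , y<x) →
  acc-⊆ (λ Pz z<y → P⊆Q Pz (<-trans z<y y<x)) (rs (P⊆Q Py y<x , y<x))

-- Each predicate keeps its own upper bound, `y` or `z`. A descent through one lowers its bound to
-- `w` and leaves the other accessibility proof intact.
acc-⊎ : ∀ {P Q x y z} → x ≤ y → x ≤ z → Acc (Below P) y → Acc (Below Q) z →
        Acc (Below λ w → P w ⊎ Q w) x
acc-⊎ x≤y x≤z y-acc@(acc rs) z-acc@(acc rs′) = acc λ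
  { (inj₁ Pw , w<x) → acc-⊎ ≤-refl (≤-trans (<⇒≤ w<x) x≤z) (rs (Pw , <-≤-trans w<x x≤y)) z-acc
  ; (inj₂ Qw , w<x) → acc-⊎ (≤-trans (<⇒≤ w<x) x≤y) ≤-refl y-acc (rs′ (Qw , <-≤-trans w<x x≤z)) }

FuseBelow : ℚ → ℚ → ℚ → Set
FuseBelow a b w = ∃[ u ] ∃[ v ] Below Fusible u a × Below Fusible v b × w ≡ fuse u v

-- Induction on `a` and `b`: by monotonicity, a member below `fuse u v` has first operand below `u`
-- or second below `v`, so it belongs to a set with one bound lowered.
acc-fuseBelow : ∀ {a b} → Acc (Below Fusible) a → Acc (Below Fusible) b →
                ∀ x → Acc (Below (FuseBelow a b)) x
acc-fuseBelow {a} {b} a-acc@(acc rs) b-acc@(acc rs′) x = acc λ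
  { ((u , v , u<a , v<b , refl) , _) → acc-⊆ (smaller u v) (acc-⊎ ≤-refl ≤-refl
      (acc-fuseBelow (rs u<a) b-acc (fuse u v)) (acc-fuseBelow a-acc (rs′ v<b) (fuse u v))) }
  where
  smaller : ∀ u v {y} → FuseBelow a b y → y < fuse u v → FuseBelow u b y ⊎ FuseBelow a v y
  smaller u v (u′ , v′ , (fu′ , u′<a) , (fv′ , v′<b) , refl) y<w with u′ <? u | v′ <? v
  ... | yes u′<u | _        = inj₁ (u′ , v′ , (fu′ , u′<u) , (fv′ , v′<b) , refl)
  ... | no _     | yes v′<v = inj₂ (u′ , v′ , (fu′ , u′<a) , (fv′ , v′<v) , refl)
  ... | no u′≮u  | no v′≮v  = contradiction (fuse-mono-≤ (≮⇒≥ u′≮u) (≮⇒≥ v′≮v)) (<⇒≱ y<w)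

level-induction : (X : ℚ → Set) → (∀ {c} → c < 0ℚ → X c) →
                  (∀ t → (∀ {c} → c < t → X c) → ∀ {c} → c < t + ½ → X c) → ∀ c → X c
level-induction X base step c = levels (proj₁ (archimedean c)) (proj₂ (archimedean c))
  where
  +1≡+½+½ : ∀ t → 1ℚ + t ≡ (t + ½) + ½
  +1≡+½+½ t = solve (t ∷ []) ℚ-ring
  levels : ∀ n {c} → c < n · 1ℚ → X c
  levels zero    c<0 = base c<0
  levels (suc n) {c} c<1+n = step _ (step _ (levels n)) (subst (c <_) (+1≡+½+½ (n · 1ℚ)) c<1+n)

ScaleStep : (ℚ → Set) → ℚ → Set
ScaleStep X t = ∀ {σ} → Fusible σ →
  (∀ {u} → Fusible u → u < σ → ∀ {x} → x < u + 1ℚ → x < t + ½ → X x) →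
  ∀ {c} → c < σ + 1ℚ → c < t + ½ → (∀ {x} → x ≤ rest c σ → X x) → X c

-- Lexicographic in σ and in the k with c ≤ σ + 1 − ½ᵏ: passing from c to
-- rest c σ doubles the distance to σ + 1.
scale-induction : (X : ℚ → Set) (t : ℚ) → (∀ {c} → c < t → X c) → ScaleStep X t →
  ∀ {σ} → Acc (Below Fusible) σ → Fusible σ → ∀ {c} → c < σ + 1ℚ → c < t + ½ → X c
scale-induction X t low step = induct
  where
  induct : ∀ {σ} → Acc (Below Fusible) σ → Fusible σ → ∀ {c} → c < σ + 1ℚ → c < t + ½ → X c
  induct {σ} (acc rs) fσ {c} c<σ+1 =
    at-scale (proj₁ small) (c+h≤σ+1 (½ ^ proj₁ small) (proj₂ small))
    where
    small = ½^-vanishes {(σ + 1ℚ) - c} (by-< 0ℚ ((σ + 1ℚ) - c) c<σ+1 (solve (σ ∷ c ∷ []) ℚ-ring))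
    c+h≤σ+1 : ∀ h → h < (σ + 1ℚ) - c → c + h ≤ σ + 1ℚ
    c+h≤σ+1 h h<ε = <⇒≤ (by-< (c + h) (σ + 1ℚ) h<ε (solve (σ ∷ c ∷ h ∷ []) ℚ-ring))
    rest<t : ∀ c → c + 1ℚ ≤ σ + 1ℚ → c < t + ½ → c + c - σ - 1ℚ < t
    rest<t c c+1≤σ+1 c<t+½ = by-< (c + c - σ - 1ℚ) t
      (+-mono-<-≤ (+-mono-≤-< c+1≤σ+1 c<t+½) (nonNegative⁻¹ ½)) (solve (σ ∷ c ∷ t ∷ []) ℚ-ring)
    rest+h≤ : ∀ c h → c + ½ * h ≤ σ + 1ℚ → (c + c - σ - 1ℚ) + h ≤ σ + 1ℚ
    rest+h≤ c h le = by-≤ ((c + c - σ - 1ℚ) + h) (σ + 1ℚ) (+-mono-≤ le le)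
      (solve (σ ∷ c ∷ h ∷ []) ℚ-ring)
    rest< : ∀ c → c < σ + 1ℚ → c + c - σ - 1ℚ < c
    rest< c lt = by-< (c + c - σ - 1ℚ) c lt (solve (σ ∷ c ∷ []) ℚ-ring)
    at-scale : ∀ k {c} → c + ½ ^ k ≤ σ + 1ℚ → c < t + ½ → X c
    at-scale k {c} c+h≤ c<t+½ =
      step fσ (λ fu u<σ → induct (rs (fu , u<σ)) fu) c<σ+1′ c<t+½ (lower k c+h≤)
      where
      c<σ+1′ : c < σ + 1ℚ
      c<σ+1′ = <-≤-trans (p<p+q c (½^n>0 k)) c+h≤
      lower : ∀ k → c + ½ ^ k ≤ σ + 1ℚ → ∀ {x} → x ≤ rest c σ → X x
      -- Here `c ≤ σ`, so `rest c σ ≤ c − 1 < t`: the doubling has reached the previous level.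
      lower zero    c+1≤ x≤ = low (≤-<-trans x≤ (rest<t c c+1≤ c<t+½))
      lower (suc k) c+½h≤ x≤ = at-scale k
        (≤-trans (+-monoˡ-≤ (½ ^ k) x≤) (rest+h≤ c (½ ^ k) c+½h≤))
        (<-trans (≤-<-trans x≤ (rest< c c<σ+1′)) c<t+½)

fusible-acc : ∀ c → Acc (Below Fusible) c
fusible-acc = level-induction (Acc (Below Fusible)) (λ c<0 → acc-≤0 (<⇒≤ c<0)) raise
  where
  acc-≤0 : ∀ {c} → c ≤ 0ℚ → Acc (Below Fusible) c
  acc-≤0 c≤0 = acc λ (fw , w<c) → contradiction (<-≤-trans w<c c≤0) (fusible≮0 fw)
  raise : ∀ t → (∀ {c} → c < t → Acc (Below Fusible) c) →
          ∀ {c} → c < t + ½ → Acc (Below Fusible) c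
  raise t low c<t+½ = acc λ (fw , w<c) → accessible fw (orderedFuse fw) (<-trans w<c c<t+½)
    where
    t-acc : Acc (Below Fusible) t
    t-acc = acc λ (_ , w<t) → low w<t
    u<t : ∀ {u v} → u ≤ v → fuse u v < t + ½ → u < t
    u<t {u} u≤v h = +-cancelʳ-< u t ½ (≤-<-trans (+½≤fuse u≤v) h)
    step : ScaleStep (Acc (Below Fusible)) t
    -- Below `c`, zero and the numbers whose smaller operand is under `σ` are already accessible.
    -- The others fuse an operand below `t` with one below `rest c σ`, and both bounds are
    -- accessible.
    step {σ} _ smaller-σ {c} _ c<t+½ lower = acc-⊆ split
      (acc-⊎ ≤-refl ≤-refl (fusibleAcc-acc c) (acc-fuseBelow t-acc (lower ≤-refl) c))
      where
      FusibleAcc : ℚ → Set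
      FusibleAcc w = Fusible w × Acc (Below Fusible) w
      fusibleAcc-acc : ∀ x → Acc (Below FusibleAcc) x
      fusibleAcc-acc x = acc λ ((_ , w-acc) , _) → acc-⊆ (λ (fz , _) _ → fz) w-acc
      split : ∀ {w} → Fusible w → w < c → FusibleAcc w ⊎ FuseBelow t (rest c σ) w
      split fw w<c with orderedFuse fw
      ... | inj₁ refl = inj₁ (fw , acc-≤0 ≤-refl)
      ... | inj₂ (u , v , fu , fv , u≤v , v<u+1 , refl) with u <? σ
      ...   | yes u<σ =
        inj₁ (fw , smaller-σ fu u<σ (fuse<+1 u v v<u+1) (<-trans w<c c<t+½))
      ...   | no  u≮σ =
        inj₂ (u , v , (fu , u<t u≤v (<-trans w<c c<t+½))
             , (fv , <-≤-trans (fuse<⇒<rest u v w<c) (rest-antitone-≤ c (≮⇒≥ u≮σ))) , refl)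
    accessible : ∀ {w} → Fusible w → w ≡ 0ℚ ⊎ OrderedFuse w → w < t + ½ → Acc (Below Fusible) w
    accessible _ (inj₁ refl) _ = acc-≤0 ≤-refl
    accessible _ (inj₂ (u , v , fu , _ , u≤v , v<u+1 , refl)) w<t+½ =
      -- `σ` starts as the smaller operand `u`, accessible because `u < t`.
      scale-induction (Acc (Below Fusible)) t low step (low (u<t u≤v w<t+½))
        fu (fuse<+1 u v v<u+1) w<t+½

-- Neighbours

-- The ends are fusible but may lie outside `S`, so brackets of the pieces of a union merge by
-- taking the larger `lo` and the smaller `hi`.
record Bracket (S : ℚ → Set) (c : ℚ) : Set where
  constructor bracket
  field
    {lo hi}    : ℚ
    lo-fusible : Fusible lo
    hi-fusible : Fusible hi
    lo≤c       : lo ≤ c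
    c<hi       : c < hi
    outside    : ∀ {w} → S w → w ≤ lo ⊎ hi ≤ w

bracket-⊆ : ∀ {P Q c} → (∀ {w} → P w → Q w) → Bracket Q c → Bracket P c
bracket-⊆ P⊆Q (bracket fl fh l≤c c<h out) = bracket fl fh l≤c c<h λ Pw → out (P⊆Q Pw)

widen : ∀ {l l′ h h′ w} → l ≤ l′ → h′ ≤ h → w ≤ l ⊎ h ≤ w → w ≤ l′ ⊎ h′ ≤ w
widen l≤l′ h′≤h = [ (λ w≤l → inj₁ (≤-trans w≤l l≤l′)) , (λ h≤w → inj₂ (≤-trans h′≤h h≤w)) ]′

⊔-fusible : ∀ {a b} → Fusible a → Fusible b → Fusible (a ⊔ b)
⊔-fusible {a} {b} fa fb with ⊔-sel a b
... | inj₁ eq = subst Fusible (sym eq) fa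
... | inj₂ eq = subst Fusible (sym eq) fb

⊓-fusible : ∀ {a b} → Fusible a → Fusible b → Fusible (a ⊓ b)
⊓-fusible {a} {b} fa fb with ⊓-sel a b
... | inj₁ eq = subst Fusible (sym eq) fa
... | inj₂ eq = subst Fusible (sym eq) fb

⊓-glb-< : ∀ {c a b} → c < a → c < b → c < a ⊓ b
⊓-glb-< {c} {a} {b} c<a c<b with ⊓-sel a b
... | inj₁ eq = subst (c <_) (sym eq) c<a
... | inj₂ eq = subst (c <_) (sym eq) c<b

bracket-∪ : ∀ {P Q c} → Bracket P c → Bracket Q c → Bracket (λ w → P w ⊎ Q w) c
bracket-∪ (bracket {l₁} {h₁} fl₁ fh₁ l₁≤c c<h₁ out₁) (bracket {l₂} {h₂} fl₂ fh₂ l₂≤c c<h₂ out₂) =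
  bracket (⊔-fusible fl₁ fl₂) (⊓-fusible fh₁ fh₂) (⊔-lub l₁≤c l₂≤c) (⊓-glb-< c<h₁ c<h₂)
    [ (λ Pw → widen (p≤p⊔q l₁ l₂) (p⊓q≤p h₁ h₂) (out₁ Pw))
    , (λ Qw → widen (p≤q⊔p l₁ l₂) (p⊓q≤q h₁ h₂) (out₂ Qw)) ]′

-- The neighbours of c in the set of fusible numbers; for c < 0 there is no lower
-- one, and any negative number stands in for it.
record Cell (c : ℚ) : Set where
  field
    {lo hi}    : ℚ
    lo-fusible : Fusible lo ⊎ lo < 0ℚ
    hi-fusible : Fusible hi
    lo≤c       : lo ≤ c
    c<hi       : c < hi
    outside    : ∀ {w} → Fusible w → w ≤ lo ⊎ hi ≤ w

FusesUpTo : ℚ → ℚ → Set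
FusesUpTo g w = ∃[ u ] ∃[ v ] Fusible u × Fusible v × u ≤ v × v < u + 1ℚ × v ≤ g × w ≡ fuse u v

rest<⇒<fuseʳ : ∀ a b {c} → rest c a < b → c < fuse a b
rest<⇒<fuseʳ a b {c} r<b = subst (c <_) (fuse-comm b a) (rest<⇒<fuse b a r<b)

LowerCorner : ℚ → ℚ → ℚ → Set
LowerCorner a b w = ∃[ u ] ∃[ v ] Fusible u × u ≤ a × v ≤ b × w ≡ fuse u v

UpperCorner : ℚ → ℚ → ℚ → Set
UpperCorner a b w = ∃[ u ] ∃[ v ] u ≤ v × v < u + 1ℚ × a ≤ u × b ≤ v × w ≡ fuse u v

fusesUpTo-split : ∀ {x y g w} (S : Cell x) (T : Cell y) → FusesUpTo g w →
  LowerCorner (Cell.lo S) g w ⊎ FusesUpTo (Cell.lo T) w ⊎ UpperCorner (Cell.hi S) (Cell.hi T) w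
fusesUpTo-split S T (u , v , fu , fv , u≤v , v<u+1 , v≤g , w≡)
  with Cell.outside S fu | Cell.outside T fv
... | inj₁ u≤lo | _         = inj₁ (u , v , fu , u≤lo , v≤g , w≡)
... | inj₂ _    | inj₁ v≤lo = inj₂ (inj₁ (u , v , fu , fv , u≤v , v<u+1 , v≤lo , w≡))
... | inj₂ hi≤u | inj₂ hi≤v = inj₂ (inj₂ (u , v , u≤v , v<u+1 , hi≤u , hi≤v , w≡))

-- 0 and `top` are default ends, for pieces that are empty or lie on one side of `c`.
module _ {c} (0≤c : 0ℚ ≤ c) {top} (top-fusible : Fusible top) (c<top : c < top) where

  bracket-≤ : ∀ {l} → Fusible l → l ≤ c → Bracket (_≤ l) c
  bracket-≤ fl l≤c = bracket fl top-fusible l≤c c<top inj₁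

  bracket-≥ : ∀ {h} → Fusible h → c < h → Bracket (h ≤_) c
  bracket-≥ fh c<h = bracket zero-fusible fh 0≤c c<h inj₂

  bracket-∅ : ∀ {P} → (∀ {w} → ¬ P w) → Bracket P c
  bracket-∅ ¬P = bracket-⊆ (λ Pw → contradiction Pw ¬P) (bracket-≤ zero-fusible 0≤c)

  bracket-<0 : ∀ {g} → g < 0ℚ → Bracket (FusesUpTo g) c
  bracket-<0 g<0 = bracket-∅ λ (_ , _ , _ , fv , _ , _ , v≤g , _) →
    fusible≮0 fv (≤-<-trans v≤g g<0)

  -- The lower end is `fuse a b`, or `b` when `b ≥ a + 1`: that fuse is then invalid, but its value
  -- is at most `b`.
  bracket-lower-corner : ∀ {a b} → Fusible a ⊎ a < 0ℚ → Fusible b → a ≤ rest c b → a ≤ b → b ≤ c →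
    Bracket (LowerCorner a b) c
  bracket-lower-corner (inj₂ a<0) _ _ _ _ = bracket-∅ λ (_ , _ , fu , u≤a , _) →
    fusible≮0 fu (≤-<-trans u≤a a<0)
  bracket-lower-corner {a} {b} (inj₁ fa) fb a≤r a≤b b≤c with b <? a + 1ℚ
  ... | yes b<a+1 = bracket-⊆ (λ { (_ , _ , _ , u≤a , v≤b , refl) → fuse-mono-≤ u≤a v≤b })
    (bracket-≤ (fuse-fusible fa fb (fusable a b (≤-<-trans a≤b (p<p+1 b)) b<a+1))
      (subst (fuse a b ≤_) (fuse-restˡ c b) (fuse-mono-≤ a≤r (≤-refl {b}))))
  ... | no b≮a+1 = bracket-⊆ (λ { (_ , _ , _ , u≤a , v≤b , refl) →
      ≤-trans (fuse-mono-≤ u≤a v≤b) (fuse-+1≤ a b (≮⇒≥ b≮a+1)) })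
    (bracket-≤ fb b≤c)

  -- If `a` and `b` are too far apart to fuse, the larger one is the upper end: it is at least
  -- `fuse a b`, hence above `c`, and every `fuse u v` in the corner exceeds `v` and so both `a` and
  -- `b`.
  bracket-upper-corner : ∀ {a b} → Fusible a → Fusible b → rest c a < b →
    Bracket (UpperCorner a b) c
  bracket-upper-corner {a} {b} fa fb r<b with b <? a + 1ℚ | a <? b + 1ℚ
  ... | yes b<a+1 | yes a<b+1 = bracket-⊆
    (λ { (_ , _ , _ , _ , a≤u , b≤v , refl) → fuse-mono-≤ a≤u b≤v })
    (bracket-≥ (fuse-fusible fa fb (fusable a b a<b+1 b<a+1)) (rest<⇒<fuseʳ a b r<b))
  ... | no b≮a+1 | _ = bracket-⊆ (λ { (u , v , _ , v<u+1 , _ , b≤v , refl) →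
      ≤-trans b≤v (<⇒≤ (b<fuse u v v<u+1)) })
    (bracket-≥ fb (<-≤-trans (rest<⇒<fuseʳ a b r<b) (fuse-+1≤ a b (≮⇒≥ b≮a+1))))
  ... | yes _ | no a≮b+1 = bracket-⊆ (λ { (u , v , u≤v , v<u+1 , a≤u , _ , refl) →
      ≤-trans a≤u (≤-trans u≤v (<⇒≤ (b<fuse u v v<u+1))) })
    (bracket-≥ fa (<-≤-trans (rest<⇒<fuseʳ a b r<b)
      (subst (_≤ a) (fuse-comm b a) (fuse-+1≤ b a (≮⇒≥ a≮b+1)))))

  module _ {b} (b≤c : b ≤ c) (cell : ∀ {x} → x + ½ ≤ c → Cell x)
           (cell′ : ∀ {x} → x ≤ b → Cell x) where

    -- The pairs (u , v) with u ∼ v near c form a staircase: the next lower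
    -- corner is found from the upper neighbour s of rest c g and from the
    -- neighbours of rest c s, the lower of which is fusible and less than g.
    bracket-fusesUpTo : ∀ {g} → Acc (Below Fusible) g → Fusible g → g ≤ b →
                        Bracket (FusesUpTo g) c
    bracket-fusesUpTo {g} (acc rs) fg g≤b with g + ½ ≤? c
    -- `fuse g g = g + ½` dominates every fuse of operands up to `g`.
    ... | yes g+½≤c = bracket-⊆
      (λ { (_ , _ , _ , _ , u≤v , _ , v≤g , refl) → fuse-mono-≤ (≤-trans u≤v v≤g) v≤g })
      (bracket-≤ (fuse-fusible fg fg (fusable g g (p<p+1 g) (p<p+1 g)))
        (subst (_≤ c) (sym (fuse-idem g)) g+½≤c))
    ... | no g+½≰c = bracket-⊆ (fusesUpTo-split S T)
      (bracket-∪ (bracket-lower-corner S.lo-fusible fg S.lo≤c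
                   (≤-trans S.lo≤c (<⇒≤ (rest<g g c<g+½))) (≤-trans g≤b b≤c))
      (bracket-∪ (descend T.lo-fusible) (bracket-upper-corner S.hi-fusible T.hi-fusible T.c<hi)))
      where
      c<g+½ : c < g + ½
      c<g+½ = ≰⇒> g+½≰c
      rest+½≤c : ∀ g → c < g + ½ → (c + c - g - 1ℚ) + ½ ≤ c
      rest+½≤c g c<g+½ = by-≤ ((c + c - g - 1ℚ) + ½) c (<⇒≤ c<g+½) (solve (c ∷ g ∷ []) ℚ-ring)
      rest<g : ∀ g → c < g + ½ → c + c - g - 1ℚ < g
      rest<g g c<g+½ = by-< (c + c - g - 1ℚ) g (+-mono-< c<g+½ c<g+½) (solve (c ∷ g ∷ []) ℚ-ring)
      S : Cell (rest c g)
      S = cell (rest+½≤c g c<g+½)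
      module S = Cell S
      r<g : rest c S.hi < g
      r<g = rest-swap-< c S.c<hi
      T : Cell (rest c S.hi)
      T = cell′ (≤-trans (<⇒≤ r<g) g≤b)
      module T = Cell T
      descend : Fusible T.lo ⊎ T.lo < 0ℚ → Bracket (FusesUpTo T.lo) c
      descend (inj₁ fg′)  = bracket-fusesUpTo (rs (fg′ , g′<g)) fg′ (≤-trans (<⇒≤ g′<g) g≤b)
        where
        g′<g = ≤-<-trans T.lo≤c r<g
      descend (inj₂ g′<0) = bracket-<0 g′<0

cell-<0 : ∀ {c} → c < 0ℚ → Cell c
cell-<0 c<0 = record
  { lo-fusible = inj₂ c<0 ; hi-fusible = zero-fusible ; lo≤c = ≤-refl ; c<hi = c<0
  ; outside = λ fw → inj₂ (fusible≥0 fw) }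

bracket⇒cell : ∀ {c} → Bracket Fusible c → Cell c
bracket⇒cell (bracket fl fh l≤c c<h out) = record
  { lo-fusible = inj₁ fl ; hi-fusible = fh ; lo≤c = l≤c ; c<hi = c<h ; outside = out }

+1-fusible : ∀ {a} → Fusible a → Fusible (a + 1ℚ)
+1-fusible fa = hasDepth⇒fusible (hasDepth-+1 (proj₂ (fusible⇒hasDepth fa)))

BelowCorner : ℚ → ℚ → Set
BelowCorner γ w = ∃[ u ] Fusible u × u ≤ γ × w ≤ u + 1ℚ

fusible-split : ∀ {x y w} (S : Cell x) (T : Cell y) → Fusible w →
  w ≤ 0ℚ ⊎ BelowCorner (Cell.lo S) w ⊎ FusesUpTo (Cell.lo T) w ⊎
  UpperCorner (Cell.hi S) (Cell.hi T) w
fusible-split S T fw with orderedFuse fw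
... | inj₁ w≡0 = inj₁ (≤-reflexive w≡0)
... | inj₂ (u , v , fu , fv , u≤v , v<u+1 , w≡) with Cell.outside S fu | Cell.outside T fv
...   | inj₁ u≤lo | _         =
  inj₂ (inj₁ (u , fu , u≤lo , ≤-trans (≤-reflexive w≡) (<⇒≤ (fuse<+1 u v v<u+1))))
...   | inj₂ _    | inj₁ v≤lo = inj₂ (inj₂ (inj₁ (u , v , fu , fv , u≤v , v<u+1 , v≤lo , w≡)))
...   | inj₂ hi≤u | inj₂ hi≤v = inj₂ (inj₂ (inj₂ (u , v , u≤v , v<u+1 , hi≤u , hi≤v , w≡)))

-- Let `σ` be the upper neighbour of `c − 1`. Numbers with smaller operand below `σ` are at most
-- `S.lo + 1 ≤ c`; for the others, the larger operand is compared with the neighbours of `rest c σ`.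
cell-above : ∀ {c} → 0ℚ ≤ c → (S : Cell (c - 1ℚ)) → (∀ {x} → x + ½ ≤ c → Cell x) →
             (∀ {x} → x ≤ rest c (Cell.hi S) → Cell x) → Cell c
cell-above {c} 0≤c S cell cell′ = bracket⇒cell (bracket-⊆ (fusible-split S T)
  (bracket-∪ (bracket-≤ 0≤c top-fusible c<top zero-fusible 0≤c)
  (bracket-∪ (below S.lo-fusible)
  (bracket-∪ (up-to T.lo-fusible)
             (bracket-upper-corner 0≤c top-fusible c<top S.hi-fusible T.hi-fusible T.c<hi)))))
  where
  module S = Cell S
  T : Cell (rest c S.hi)
  T = cell′ ≤-refl
  module T = Cell T
  top-fusible : Fusible (S.hi + 1ℚ)
  top-fusible = +1-fusible S.hi-fusible
  c<top : c < S.hi + 1ℚ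
  c<top = unfolded S.hi S.c<hi
    where
    unfolded : ∀ σ → c - 1ℚ < σ → c < σ + 1ℚ
    unfolded σ lt = by-< c (σ + 1ℚ) lt (solve (c ∷ σ ∷ []) ℚ-ring)
  rest≤c : rest c S.hi ≤ c
  rest≤c = unfolded S.hi c<top
    where
    unfolded : ∀ σ → c < σ + 1ℚ → c + c - σ - 1ℚ ≤ c
    unfolded σ lt = by-≤ (c + c - σ - 1ℚ) c (<⇒≤ lt) (solve (c ∷ σ ∷ []) ℚ-ring)
  lo+1≤c : S.lo + 1ℚ ≤ c
  lo+1≤c = unfolded S.lo S.lo≤c
    where
    unfolded : ∀ γ → γ ≤ c - 1ℚ → γ + 1ℚ ≤ c
    unfolded γ le = by-≤ (γ + 1ℚ) c le (solve (c ∷ γ ∷ []) ℚ-ring)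
  below : Fusible S.lo ⊎ S.lo < 0ℚ → Bracket (BelowCorner S.lo) c
  below (inj₁ flo) = bracket-⊆ (λ (_ , _ , u≤lo , w≤u+1) → ≤-trans w≤u+1 (+-monoˡ-≤ 1ℚ u≤lo))
    (bracket-≤ 0≤c top-fusible c<top (+1-fusible flo) lo+1≤c)
  below (inj₂ lo<0) = bracket-∅ 0≤c top-fusible c<top λ (_ , fu , u≤lo , _) →
    fusible≮0 fu (≤-<-trans u≤lo lo<0)
  up-to : Fusible T.lo ⊎ T.lo < 0ℚ → Bracket (FusesUpTo T.lo) c
  up-to (inj₁ flo)  =
    bracket-fusesUpTo 0≤c top-fusible c<top rest≤c cell cell′ (fusible-acc T.lo) flo T.lo≤c
  up-to (inj₂ lo<0) = bracket-<0 0≤c top-fusible c<top lo<0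

cell : ∀ c → Cell c
cell = level-induction Cell cell-<0 raise
  where
  raise : ∀ t → (∀ {c} → c < t → Cell c) → ∀ {c} → c < t + ½ → Cell c
  raise t low {c} c<t+½ =
    -- The start `σ` is the upper neighbour of `c − 1`, known from the level below.
    scale-induction Cell t low step (fusible-acc _) σ-fusible c<σ+1 c<t+½
    where
    c-1<t : ∀ {c} → c < t + ½ → c - 1ℚ < t
    c-1<t {c} c<t+½ = by-< (c - 1ℚ) t (+-mono-<-≤ c<t+½ (nonNegative⁻¹ ½))
      (solve (c ∷ t ∷ []) ℚ-ring)
    <+1 : ∀ {c s} → c - 1ℚ < s → c < s + 1ℚ
    <+1 {c} {s} lt = by-< c (s + 1ℚ) lt (solve (c ∷ s ∷ []) ℚ-ring)
    open Cell (low (c-1<t c<t+½)) renaming (hi to σ; hi-fusible to σ-fusible; c<hi to c-1<σ)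
    c<σ+1 : c < σ + 1ℚ
    c<σ+1 = <+1 c-1<σ
    step : ScaleStep Cell t
    step {τ} _ smaller {c} _ c<t+½ lower with 0ℚ ≤? c
    ... | no  0≰c = cell-<0 (≰⇒> 0≰c)
    ... | yes 0≤c = dichotomy (low (c-1<t c<t+½))
      where
      dichotomy : Cell (c - 1ℚ) → Cell c
      -- If the upper neighbour of `c − 1` is below `τ`, it can replace `τ` outright. Otherwise
      -- `rest c (Cell.hi S) ≤ rest c τ`, within reach of `lower`.
      dichotomy S with Cell.hi S <? τ
      ... | yes σ<τ = smaller (Cell.hi-fusible S) σ<τ (<+1 (Cell.c<hi S)) c<t+½
      ... | no  σ≮τ = cell-above 0≤c S
        (λ {x} x+½≤c → low (+-cancelʳ-< x t ½ (≤-<-trans x+½≤c c<t+½)))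
        (λ x≤ → lower (≤-trans x≤ (rest-antitone-≤ c (≮⇒≥ σ≮τ))))

-- Existence of successors and the gap formula

successor : ∀ a → ∃[ b ] IsSuccessor a b
successor a = hi , (hi-fusible , c<hi) , λ w fw a<w →
  [ (λ w≤lo → contradiction (≤-trans w≤lo lo≤c) (<⇒≱ a<w)) , id ]′ (outside fw)
  where
  open Cell (cell a)

theorem7 : ∀ (a : ℚ) → Fusible a →
    ∃[ d ] ∃[ s ] ∃[ m ] ∃[ m′ ]
    IsDepth a d × IsSuccessor a s × IsGap a m × IsGap s m′
    × m ≡ ½ ^ suc d × m′ ≡ ½ * m
theorem7 a fa =
  depth-and-gaps fa (proj₂ (successor a)) (proj₂ (successor (proj₁ (successor a))))
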